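{- Let $G=(V,E)$ be a locally finite simple graph and $x\in V$. Then the curvature function $\mathcal K_{G,x}:(0,\infty]\to\mathbb R$ has the following properties: (i) $\mathcal K_{G,x}$ is monotone non-decreasing. (ii) $\mathcal K_{G,x}$ is continuous. (iii) For any $\mathcal N\in(0,\infty]$, $$\mathcal K_{G,x}(\infty)-\frac{2d_x}{\mathcal N}\le\mathcal K_{G,x}(\mathcal N)\le\mathcal K_\infty^0(x)-\frac{2d_x}{\mathcal N}.$$ In particular, $\lim_{\mathcal N\to0}\mathcal K_{G,x}(\mathcal N)=-\infty$. (iv) $\mathcal K_{G,x}$ is a concave function.
   Context: Graphs are undirected, without loops or multiple edges, and every vertex has finite degree; $d_x$ is the degree of $x$, and the vertex $x$ considered has $d_x\ge1$. For $f:V\to\mathbb R$ put $\Delta f(x)=\sum_{y\sim x}(f(y)-f(x))$ (non-normalized Laplacian), and for $f,g:V\to\mathbb R$ put $2\Gamma(f,g)=\Delta(fg)-f\Delta g-g\Delta f$, $2\Gamma_2(f,g)=\Delta\Gamma(f,g)-\Gamma(f,\Delta g)-\Gamma(\Delta f,g)$, $\Gamma(f)=\Gamma(f,f)$, $\Gamma_2(f)=\Gamma_2(f,f)$. For $\mathcal N\in(0,\infty]$ (convention $1/\infty=0$), $\mathcal K_{G,x}(\mathcal N)$ is the largest $K\in\mathbb R$ such that $\Gamma_2(f)(x)\ge\frac1{\mathcal N}(\Delta f(x))^2+K\,\Gamma(f)(x)$ for all $f:V\to\mathbb R$ (Bakry-Émery curvature function). $S_1(x)$ is the set of neighbours of $x$.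 For $y\in S_1(x)$, the out degree $d_y^+$ is the number of neighbours of $y$ at graph distance $2$ from $x$; $av_1^+(x)=\frac1{d_x}\sum_{y\in S_1(x)}d_y^+$; and $\mathcal K_\infty^0(x)=\frac{3+d_x-av_1^+(x)}2$. Continuity on $(0,\infty]$ includes $\lim_{\mathcal N\to\infty}\mathcal K_{G,x}(\mathcal N)=\mathcal K_{G,x}(\infty)$. Concavity means $\mathcal K_{G,x}(\alpha\mathcal N_1+(1-\alpha)\mathcal N_2)\ge\alpha\mathcal K_{G,x}(\mathcal N_1)+(1-\alpha)\mathcal K_{G,x}(\mathcal N_2)$ for finite $\mathcal N_1,\mathcal N_2>0$ and $\alpha\in[0,1]$. -}

module Defs where

open import Level using (0ℓ)
open import Algebra.Bundles using (CommutativeRing)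
open import Algebra.Structures using (IsCommutativeRing)
import Algebra.Definitions.RawMonoid as RawMonoidDefs
open import Axiom.ExcludedMiddle using (ExcludedMiddle)
open import Data.List.Base using (List; length; map; foldr; filter)
open import Data.List.Membership.Propositional using (_∈_)
open import Data.List.Relation.Unary.Unique.Propositional using (Unique)
open import Data.Nat.Base as ℕ using (ℕ; zero; suc)
open import Data.Product.Base using (Σ-syntax; ∃-syntax; _×_; _,_; proj₁)
open import Data.Sum.Base using ([_,_]′)
open import Function.Bundles using (_⇔_)
open import Relation.Binary.Core using (Rel)
open import Relation.Binary.Definitions using (Symmetric; Irreflexive)
open import Relation.Binary.PropositionalEquality.Core using (_≡_)
open import Relation.Binary.Structures using (IsTotalOrder)
import Relation.Binary.Construct.Add.Supremum.NonStrict as AddSupremum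
import Relation.Binary.Construct.NonStrictToStrict as ToStrict
open import Relation.Nullary.Construct.Add.Supremum using (_⁺; [_]; ⊤⁺)
open import Relation.Nullary.Negation.Core using (¬_)

-- The library has no real numbers.  They are described here by the axioms of a
-- Dedekind-complete ordered field, which determine ℝ up to isomorphism.
record RealField : Set₁ where
  infix  4 _≈_ _≤_ _<_
  infixl 6 _+_
  infixl 7 _*_ _÷_
  infix  8 -_ _⁻¹
  field
    Carrier           : Set
    _≈_ _≤_           : Rel Carrier 0ℓ
    _+_ _*_           : Carrier → Carrier → Carrier
    -_                : Carrier → Carrier
    0# 1#             : Carrier
    isCommutativeRing : IsCommutativeRing _≈_ _+_ _*_ -_ 0# 1#
    0≉1               : ¬ (0# ≈ 1#)

    -- Total for convenience: nothing is assumed about the value at 0#.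
    _⁻¹               : Carrier → Carrier
    *-inverseʳ        : ∀ x → ¬ (x ≈ 0#) → x * x ⁻¹ ≈ 1#

    isTotalOrder      : IsTotalOrder _≈_ _≤_
    +-monoˡ-≤         : ∀ z {x y} → x ≤ y → x + z ≤ y + z
    *-nonneg          : ∀ {x y} → 0# ≤ x → 0# ≤ y → 0# ≤ x * y

  IsUpperBound : Carrier → (Carrier → Set) → Set
  IsUpperBound b P = ∀ {x} → P x → x ≤ b

  field
    complete : ∀ (P : Carrier → Set) → (∃[ x ] P x) → (∃[ b ] IsUpperBound b P) →
               ∃[ s ] IsUpperBound s P × (∀ b → IsUpperBound b P → s ≤ b)

  commutativeRing : CommutativeRing 0ℓ 0ℓ
  commutativeRing = record { isCommutativeRing = isCommutativeRing }

  open CommutativeRing commutativeRing public using (_-_; +-rawMonoid)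
  open IsTotalOrder isTotalOrder public using (total)

  _<_ : Rel Carrier 0ℓ
  _<_ = ToStrict._<_ _≈_ _≤_

  _÷_ : Carrier → Carrier → Carrier
  x ÷ y = x * y ⁻¹

  ∣_∣ : Carrier → Carrier
  ∣ x ∣ = [ (λ _ → x) , (λ _ → - x) ]′ (total 0# x)

  fromℕ : ℕ → Carrier
  fromℕ n = RawMonoidDefs._×_ +-rawMonoid n 1#

  IsGreatest : Carrier → (Carrier → Set) → Set
  IsGreatest m P = P m × IsUpperBound m P

  Positive : Set
  Positive = Σ[ N ∈ Carrier ] 0# < N

record Graph : Set₁ where
  infix 4 _∼_
  field
    V                 : Set
    _∼_               : Rel V 0ℓ
    ∼-sym             : Symmetric _∼_
    ∼-irrefl          : Irreflexive _≡_ _∼_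
    neighbours        : V → List V
    neighbours-unique : ∀ x → Unique (neighbours x)
    ∈-neighbours      : ∀ x y → y ∈ neighbours x ⇔ x ∼ y

  degree : V → ℕ
  degree x = length (neighbours x)

  data Walk : V → V → ℕ → Set where
    here : ∀ {x} → Walk x x zero
    step : ∀ {x y z n} → x ∼ y → Walk y z n → Walk x z (suc n)

  AtDistance : V → V → ℕ → Set
  AtDistance x y n = Walk x y n × (∀ m → m ℕ.< n → ¬ Walk x y m)

-- Functions (0,∞] → ℝ, with ⊤⁺ in the role of ∞.
module ExtendedDimension (ℝ : RealField) where
  open RealField ℝ

  Dim : Set
  Dim = Positive ⁺

  open AddSupremum {A = Positive} (λ N M → proj₁ N ≤ proj₁ M) public
    using () renaming (_≤⁺_ to _≤ᴰ_)

  recip : Dim → Carrier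
  recip [ N , _ ] = N ⁻¹
  recip ⊤⁺        = 0#

  NonDecreasing : (Dim → Carrier) → Set
  NonDecreasing F = ∀ {N M} → N ≤ᴰ M → F N ≤ F M

  -- The sets (M,∞] form a neighbourhood basis of ∞.
  ContinuousAt : (Dim → Carrier) → Dim → Set
  ContinuousAt F [ N₀ , p₀ ] =
    ∀ ε → 0# < ε → ∃[ δ ] 0# < δ ×
      (∀ N (p : 0# < N) → ∣ N - N₀ ∣ < δ → ∣ F [ N , p ] - F [ N₀ , p₀ ] ∣ < ε)
  ContinuousAt F ⊤⁺ =
    ∀ ε → 0# < ε → ∃[ M ] 0# < M ×
      (∀ N (p : 0# < N) → M < N → ∣ F [ N , p ] - F ⊤⁺ ∣ < ε)

  Continuous : (Dim → Carrier) → Set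
  Continuous F = ∀ N → ContinuousAt F N

  TendsTo-∞At0 : (Dim → Carrier) → Set
  TendsTo-∞At0 F =
    ∀ B → ∃[ δ ] 0# < δ × (∀ N (p : 0# < N) → N < δ → F [ N , p ] < B)

  -- Positivity of the convex combination is part of the claim, not a hypothesis.
  Concave : (Dim → Carrier) → Set
  Concave F =
    ∀ N₁ N₂ (p₁ : 0# < N₁) (p₂ : 0# < N₂) α → 0# ≤ α → α ≤ 1# →
    Σ[ p ∈ 0# < α * N₁ + (1# - α) * N₂ ]
      α * F [ N₁ , p₁ ] + (1# - α) * F [ N₂ , p₂ ] ≤ F [ α * N₁ + (1# - α) * N₂ , p ]

-- Excluded middle decides which vertices are at distance 2, so that they can be
-- counted in outDegree.
module BakryÉmery (em : ExcludedMiddle 0ℓ) (ℝ : RealField) (G : Graph) where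
  open RealField ℝ
  open ExtendedDimension ℝ
  open Graph G

  ∑∼ : V → (V → Carrier) → Carrier
  ∑∼ x h = foldr _+_ 0# (map h (neighbours x))

  infixl 7 _·_
  _·_ : (V → Carrier) → (V → Carrier) → V → Carrier
  (f · g) x = f x * g x

  Δ : (V → Carrier) → V → Carrier
  Δ f x = ∑∼ x (λ y → f y - f x)

  Γ : (V → Carrier) → (V → Carrier) → V → Carrier
  Γ f g x = (Δ (f · g) x - f x * Δ g x - g x * Δ f x) ÷ fromℕ 2

  Γ₂ : (V → Carrier) → (V → Carrier) → V → Carrier
  Γ₂ f g x = (Δ (Γ f g) x - Γ f (Δ g) x - Γ (Δ f) g x) ÷ fromℕ 2

  CurvatureDimension : V → Dim → Carrier → Set
  CurvatureDimension x N K =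
    ∀ (f : V → Carrier) → recip N * (Δ f x * Δ f x) + K * Γ f f x ≤ Γ₂ f f x

  IsCurvatureFunction : V → (Dim → Carrier) → Set
  IsCurvatureFunction x 𝒦 = ∀ N → IsGreatest (𝒦 N) (CurvatureDimension x N)

  outDegree : V → V → ℕ
  outDegree x y = length (filter (λ z → em {AtDistance x z 2}) (neighbours y))

  av₁⁺ : V → Carrier
  av₁⁺ x = ∑∼ x (λ y → fromℕ (outDegree x y)) ÷ fromℕ (degree x)

  𝒦⁰∞ : V → Carrier
  𝒦⁰∞ x = (fromℕ 3 + fromℕ (degree x) - av₁⁺ x) ÷ fromℕ 2

{-# OPTIONS --safe #-}
module Submission where

-- Write b(y) = f(y) - f(x) and q = ∑ b(y)² over the neighbours y of x, so 2Γ(f)(x) = q and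
--   4Γ₂(f)(x) = ∑_y ∑_{z∼y} [(f(z) - f(y))² - 2 b(y)(f(z) - f(y))] - d q + 2(Δf(x))².
-- Completing squares bounds this below by a multiple of q, and the distance from x as test
-- function bounds the curvature above by 𝒦⁰∞ - 2d/N; completeness then gives a greatest K.
-- By Cauchy-Schwarz (Δf(x))² ≤ 2d Γ(f)(x), so raising 1/N by t costs at most 2dt of
-- curvature: 𝒦 is non-increasing and 2d-Lipschitz in 1/N.  This yields monotonicity,
-- continuity and the lower bound, while concavity follows from convexity of N ↦ 1/N.

open import Defs
open import Algebra.Bundles using (CommutativeRing)
import Algebra.Properties.AbelianGroup as AbelianGroupProperties
import Algebra.Properties.Ring as RingProperties
import Algebra.Properties.Semiring.Mult as Mult
import Algebra.Solver.Ring as RingSolver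
open import Algebra.Solver.Ring.AlmostCommutativeRing
  using (AlmostCommutativeRing; fromCommutativeRing; _-Raw-AlmostCommutative⟶_)
open import Axiom.ExcludedMiddle using (ExcludedMiddle)
import Data.Integer.Base as ℤ
import Data.Integer.Properties as ℤ
open import Data.List.Base using (List; []; _∷_; length; map; foldr; filter)
open import Data.List.Membership.Propositional using (_∈_)
open import Data.List.Relation.Unary.All as All using ([]; _∷_)
open import Data.List.Relation.Unary.AllPairs.Core using (_∷_)
open import Data.List.Relation.Unary.Any using (here; there)
open import Data.List.Relation.Unary.Unique.Propositional using (Unique)
open import Data.Maybe.Base using (just; nothing)
open import Data.Nat.Base as ℕ using (zero; suc)
import Data.Nat.Properties as ℕ
open import Data.Product.Base using (_×_; _,_; proj₁; proj₂; ∃-syntax)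
import Data.Sign.Base as Sign
open import Data.Sum.Base using (inj₁; inj₂)
open import Function.Bundles using (Equivalence)
open import Level using (0ℓ)
open import Relation.Binary.Bundles using (Poset)
import Relation.Binary.Construct.Add.Supremum.NonStrict as AddSupremum
import Relation.Binary.Construct.NonStrictToStrict as ToStrict
open import Relation.Binary.Definitions using (WeaklyDecidable)
open import Relation.Binary.PropositionalEquality.Core as ≡ using (_≡_)
import Relation.Binary.Reasoning.PartialOrder as PartialOrderReasoning
import Relation.Binary.Reasoning.Setoid as SetoidReasoning
open import Relation.Binary.Structures using (IsTotalOrder)
open import Relation.Nullary.Construct.Add.Supremum using (⊤⁺; [_])
open import Relation.Nullary.Decidable.Core using (Dec; yes; no)
open import Relation.Nullary.Negation.Core using (¬_; contradiction)

-- The ring solver with integer coefficients, so that it can cancel terms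
-- although equality on R is not decidable.
module IntegerSolver (R : CommutativeRing 0ℓ 0ℓ) where
  open CommutativeRing R hiding (zero)
  open Mult semiring using (×-homo-+; ×1-homo-*) renaming (_×_ to _⨯_)
  open RingProperties ring
    using (-0#≈0#; -‿involutive; -‿distribˡ-*; -‿distribʳ-*)
  open AbelianGroupProperties +-abelianGroup using (⁻¹-∙-comm)
  open SetoidReasoning setoid

  ⟦_⟧ℤ : ℤ.ℤ → Carrier
  ⟦ ℤ.+ n ⟧ℤ      = n ⨯ 1#
  ⟦ ℤ.-[1+ n ] ⟧ℤ = - (suc n ⨯ 1#)

  ⟦-⟧-homo : ∀ i → ⟦ ℤ.- i ⟧ℤ ≈ - ⟦ i ⟧ℤ
  ⟦-⟧-homo (ℤ.+ zero)    = sym -0#≈0#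
  ⟦-⟧-homo (ℤ.+ suc n)   = refl
  ⟦-⟧-homo ℤ.-[1+ n ]    = sym (-‿involutive _)

  -- Done by hand because the solver is still under construction here. With `a = 1#` it is the
  -- successor step of `⟦⊖⟧`.
  +-cancel-shift : ∀ a b c → (a + b) - (a + c) ≈ b - c
  +-cancel-shift a b c = begin
    (a + b) - (a + c)       ≈⟨ +-congˡ (⁻¹-∙-comm a c) ⟨
    (a + b) + (- a + - c)   ≈⟨ +-congʳ (+-comm a b) ⟩
    (b + a) + (- a + - c)   ≈⟨ +-assoc b a _ ⟩
    b + (a + (- a + - c))   ≈⟨ +-congˡ (+-assoc a (- a) (- c)) ⟨
    b + ((a - a) + - c)     ≈⟨ +-congˡ (+-congʳ (-‿inverseʳ a)) ⟩
    b + (0# + - c)          ≈⟨ +-congˡ (+-identityˡ (- c)) ⟩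
    b - c                   ∎

  -- Integer addition with opposite signs computes to `⊖`, so this settles both mixed cases of
  -- `⟦+⟧-homo`.
  ⟦⊖⟧ : ∀ m n → ⟦ m ℤ.⊖ n ⟧ℤ ≈ m ⨯ 1# - n ⨯ 1#
  ⟦⊖⟧ m zero = begin
    ⟦ m ℤ.⊖ zero ⟧ℤ ≡⟨ ≡.cong ⟦_⟧ℤ (ℤ.⊖-≥ {m} {zero} ℕ.z≤n) ⟩
    m ⨯ 1#          ≈⟨ +-identityʳ _ ⟨
    m ⨯ 1# + 0#     ≈⟨ +-congˡ -0#≈0# ⟨
    m ⨯ 1# - 0#     ∎
  ⟦⊖⟧ zero (suc n) = sym (+-identityˡ _)
  ⟦⊖⟧ (suc m) (suc n) = begin
    ⟦ suc m ℤ.⊖ suc n ⟧ℤ    ≡⟨ ≡.cong ⟦_⟧ℤ (ℤ.[1+m]⊖[1+n]≡m⊖n m n) ⟩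
    ⟦ m ℤ.⊖ n ⟧ℤ            ≈⟨ ⟦⊖⟧ m n ⟩
    m ⨯ 1# - n ⨯ 1#         ≈⟨ +-cancel-shift 1# _ _ ⟨
    suc m ⨯ 1# - suc n ⨯ 1# ∎

  ⟦+⟧-homo : ∀ i j → ⟦ i ℤ.+ j ⟧ℤ ≈ ⟦ i ⟧ℤ + ⟦ j ⟧ℤ
  ⟦+⟧-homo (ℤ.+ m)    (ℤ.+ n)    = ×-homo-+ 1# m n
  ⟦+⟧-homo (ℤ.+ m)    ℤ.-[1+ n ] = ⟦⊖⟧ m (suc n)
  ⟦+⟧-homo ℤ.-[1+ m ] (ℤ.+ n)    = trans (⟦⊖⟧ n (suc m)) (+-comm _ _)
  ⟦+⟧-homo ℤ.-[1+ m ] ℤ.-[1+ n ] = begin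
    - (suc (suc (m ℕ.+ n)) ⨯ 1#)      ≡⟨ ≡.cong (λ k → - (suc k ⨯ 1#)) (ℕ.+-suc m n) ⟨
    - ((suc m ℕ.+ suc n) ⨯ 1#)        ≈⟨ -‿cong (×-homo-+ 1# (suc m) (suc n)) ⟩
    - (suc m ⨯ 1# + suc n ⨯ 1#)       ≈⟨ ⁻¹-∙-comm _ _ ⟨
    - (suc m ⨯ 1#) + - (suc n ⨯ 1#)   ∎

  ⟦-◃⟧ : ∀ n → ⟦ Sign.- ℤ.◃ n ⟧ℤ ≈ - (n ⨯ 1#)
  ⟦-◃⟧ zero    = sym -0#≈0#
  ⟦-◃⟧ (suc n) = refl

  ⟦+◃⟧ : ∀ n → ⟦ Sign.+ ℤ.◃ n ⟧ℤ ≈ n ⨯ 1#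
  ⟦+◃⟧ zero    = refl
  ⟦+◃⟧ (suc n) = refl

  ⟦*⟧-homo : ∀ i j → ⟦ i ℤ.* j ⟧ℤ ≈ ⟦ i ⟧ℤ * ⟦ j ⟧ℤ
  ⟦*⟧-homo (ℤ.+ m) (ℤ.+ n) = trans (⟦+◃⟧ (m ℕ.* n)) (×1-homo-* m n)
  ⟦*⟧-homo (ℤ.+ m) ℤ.-[1+ n ] = begin
    ⟦ Sign.- ℤ.◃ m ℕ.* suc n ⟧ℤ  ≈⟨ ⟦-◃⟧ (m ℕ.* suc n) ⟩
    - ((m ℕ.* suc n) ⨯ 1#)       ≈⟨ -‿cong (×1-homo-* m (suc n)) ⟩
    - (m ⨯ 1# * suc n ⨯ 1#)      ≈⟨ -‿distribʳ-* _ _ ⟩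
    m ⨯ 1# * - (suc n ⨯ 1#)      ∎
  ⟦*⟧-homo ℤ.-[1+ m ] (ℤ.+ n) = begin
    ⟦ Sign.- ℤ.◃ suc m ℕ.* n ⟧ℤ  ≈⟨ ⟦-◃⟧ (suc m ℕ.* n) ⟩
    - ((suc m ℕ.* n) ⨯ 1#)       ≈⟨ -‿cong (×1-homo-* (suc m) n) ⟩
    - (suc m ⨯ 1# * n ⨯ 1#)      ≈⟨ -‿distribˡ-* _ _ ⟩
    - (suc m ⨯ 1#) * n ⨯ 1#      ∎
  ⟦*⟧-homo ℤ.-[1+ m ] ℤ.-[1+ n ] = begin
    (suc m ℕ.* suc n) ⨯ 1#            ≈⟨ ×1-homo-* (suc m) (suc n) ⟩
    suc m ⨯ 1# * suc n ⨯ 1#           ≈⟨ -‿involutive _ ⟨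
    - (- (suc m ⨯ 1# * suc n ⨯ 1#))   ≈⟨ -‿cong (-‿distribʳ-* _ _) ⟩
    - (suc m ⨯ 1# * - (suc n ⨯ 1#))   ≈⟨ -‿distribˡ-* _ _ ⟩
    - (suc m ⨯ 1#) * - (suc n ⨯ 1#)   ∎

  almostCommutativeRing : AlmostCommutativeRing 0ℓ 0ℓ
  almostCommutativeRing = fromCommutativeRing R

  morphism : ℤ.+-*-rawRing -Raw-AlmostCommutative⟶ almostCommutativeRing
  morphism = record
    { ⟦_⟧    = ⟦_⟧ℤ
    ; +-homo = ⟦+⟧-homo
    ; *-homo = ⟦*⟧-homo
    ; -‿homo = ⟦-⟧-homo
    ; 0-homo = refl
    -- The integer 1 is interpreted as `1# + 0#`.
    ; 1-homo = +-identityʳ 1#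
    }

  ⟦⟧-≟ : WeaklyDecidable (λ i j → ⟦ i ⟧ℤ ≈ ⟦ j ⟧ℤ)
  ⟦⟧-≟ i j with i ℤ.≟ j
  ... | yes ≡.refl = just refl
  ... | no  _      = nothing

  open RingSolver ℤ.+-*-rawRing almostCommutativeRing morphism ⟦⟧-≟ public
    using (Polynomial; solve; _:=_; _:+_; _:*_; _:-_; :-_; con)

-- Arithmetic and order in the real field.

module OrderedField (ℝ : RealField) where
  open RealField ℝ
  open CommutativeRing commutativeRing public
    using (setoid; refl; sym; trans; -‿cong; -‿inverseʳ; distribʳ; zeroˡ; zeroʳ;
           +-cong; +-congˡ; +-congʳ; +-comm; +-identityˡ; +-identityʳ;
           *-cong; *-congˡ; *-congʳ; *-comm; *-assoc; *-identityˡ; *-identityʳ)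
  open IsTotalOrder isTotalOrder public
    using (isPartialOrder; antisym; ≤-respˡ-≈; ≤-respʳ-≈)
    renaming (refl to ≤-refl; trans to ≤-trans; reflexive to ≤-reflexive)
  open IntegerSolver commutativeRing public

  poset : Poset 0ℓ 0ℓ 0ℓ
  poset = record { isPartialOrder = isPartialOrder }

  module ≤-Reasoning = PartialOrderReasoning poset

  <⇒≤ : ∀ {x y} → x < y → x ≤ y
  <⇒≤ = proj₁

  <-≤-trans : ∀ {x y z} → x < y → y ≤ z → x < z
  <-≤-trans = ToStrict.<-≤-trans _≈_ _≤_ sym ≤-trans antisym ≤-respʳ-≈

  ≤-<-trans : ∀ {x y z} → x ≤ y → y < z → x < z
  ≤-<-trans = ToStrict.≤-<-trans _≈_ _≤_ ≤-trans antisym ≤-respˡ-≈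

  -- By definition `con (ℤ.+ n)` and `fromℕ n` are the same iterated sum of `1#`, so these match the
  -- numerals in the goals. A bare `1#` is not of that form and enters the solver as a variable.
  :2 :4 : ∀ {n} → Polynomial n
  :2 = con (ℤ.+ 2)
  :4 = con (ℤ.+ 4)

  x+[y-x]≈y : ∀ x y → x + (y - x) ≈ y
  x+[y-x]≈y = solve 2 (λ x y → x :+ (y :- x) := y) refl

  +-monoʳ-≤ : ∀ z {x y} → x ≤ y → z + x ≤ z + y
  +-monoʳ-≤ z x≤y =
    ≤-respˡ-≈ (+-comm _ z) (≤-respʳ-≈ (+-comm _ z) (+-monoˡ-≤ z x≤y))

  +-mono-≤ : ∀ {x y u v} → x ≤ y → u ≤ v → x + u ≤ y + v
  +-mono-≤ x≤y u≤v = ≤-trans (+-monoˡ-≤ _ x≤y) (+-monoʳ-≤ _ u≤v)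

  +-cancelʳ-≤ : ∀ z {x y} → x + z ≤ y + z → x ≤ y
  +-cancelʳ-≤ z x+z≤y+z =
    ≤-respˡ-≈ (cancel _) (≤-respʳ-≈ (cancel _) (+-monoˡ-≤ (- z) x+z≤y+z))
    where
    cancel : ∀ x → (x + z) - z ≈ x
    cancel x = solve 2 (λ x z → (x :+ z) :- z := x) refl x z

  -- Reduces a polynomial inequality to an identity for the solver, once a nonnegative excess `p`
  -- has been exhibited.
  ≤-excess : ∀ {x y p} → 0# ≤ p → y ≈ x + p → x ≤ y
  ≤-excess {x} 0≤p y≈x+p =
    ≤-respˡ-≈ (+-identityʳ x) (≤-respʳ-≈ (sym y≈x+p) (+-monoʳ-≤ x 0≤p))

  <-excess : ∀ {x y p} → 0# < p → y ≈ x + p → x < y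
  <-excess {x} {y} {p} (0≤p , 0≉p) y≈x+p = ≤-excess 0≤p y≈x+p , λ x≈y → 0≉p (begin
    0#            ≈⟨ -‿inverseʳ y ⟨
    y - y         ≈⟨ +-cong y≈x+p (-‿cong (sym x≈y)) ⟩
    (x + p) - x   ≈⟨ solve 2 (λ x p → (x :+ p) :- x := p) refl x p ⟩
    p             ∎)
    where open SetoidReasoning setoid

  x≤y⇒0≤y-x : ∀ {x y} → x ≤ y → 0# ≤ y - x
  x≤y⇒0≤y-x {x} x≤y = ≤-respˡ-≈ (-‿inverseʳ x) (+-monoˡ-≤ (- x) x≤y)

  x<y⇒0<y-x : ∀ {x y} → x < y → 0# < y - x
  x<y⇒0<y-x {x} {y} (x≤y , x≉y) = x≤y⇒0≤y-x x≤y , λ 0≈y-x → x≉y (begin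
    x             ≈⟨ +-identityʳ x ⟨
    x + 0#        ≈⟨ +-congˡ 0≈y-x ⟩
    x + (y - x)   ≈⟨ x+[y-x]≈y x y ⟩
    y             ∎)
    where open SetoidReasoning setoid

  +-nonneg : ∀ {x y} → 0# ≤ x → 0# ≤ y → 0# ≤ x + y
  +-nonneg 0≤x 0≤y = ≤-respˡ-≈ (+-identityʳ 0#) (+-mono-≤ 0≤x 0≤y)

  +-pos-nonneg : ∀ {x y} → 0# < x → 0# ≤ y → 0# < x + y
  +-pos-nonneg 0<x 0≤y = <-≤-trans 0<x (≤-excess 0≤y refl)

  +-nonneg-pos : ∀ {x y} → 0# ≤ x → 0# < y → 0# < x + y
  +-nonneg-pos 0≤x 0<y = <-≤-trans 0<y (≤-excess 0≤x (+-comm _ _))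

  neg-nonneg : ∀ {x} → x ≤ 0# → 0# ≤ - x
  neg-nonneg x≤0 = ≤-respʳ-≈ (+-identityˡ _) (x≤y⇒0≤y-x x≤0)

  0≤x*x : ∀ x → 0# ≤ x * x
  0≤x*x x with total 0# x
  ... | inj₁ 0≤x = *-nonneg 0≤x 0≤x
  ... | inj₂ x≤0 = ≤-respʳ-≈ (solve 1 (λ x → (:- x) :* (:- x) := x :* x) refl x)
                     (*-nonneg (neg-nonneg x≤0) (neg-nonneg x≤0))

  0<1 : 0# < 1#
  0<1 = ≤-respʳ-≈ (*-identityˡ 1#) (0≤x*x 1#) , 0≉1

  0≤fromℕ : ∀ n → 0# ≤ fromℕ n
  0≤fromℕ zero    = ≤-refl
  0≤fromℕ (suc n) = +-nonneg (<⇒≤ 0<1) (0≤fromℕ n)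

  0<fromℕ : ∀ {n} → 1 ℕ.≤ n → 0# < fromℕ n
  0<fromℕ (ℕ.s≤s {n = n} _) = +-pos-nonneg 0<1 (0≤fromℕ n)

  0<2 : 0# < fromℕ 2
  0<2 = 0<fromℕ {2} (ℕ.s≤s ℕ.z≤n)

  0<4 : 0# < fromℕ 4
  0<4 = 0<fromℕ {4} (ℕ.s≤s ℕ.z≤n)

  *-monoˡ-≤ : ∀ {c x y} → 0# ≤ c → x ≤ y → c * x ≤ c * y
  *-monoˡ-≤ {c} {x} {y} 0≤c x≤y = ≤-excess (*-nonneg 0≤c (x≤y⇒0≤y-x x≤y))
    (solve 3 (λ c x y → c :* y := c :* x :+ c :* (y :- x)) refl c x y)

  *-monoʳ-≤ : ∀ {c x y} → 0# ≤ c → x ≤ y → x * c ≤ y * c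
  *-monoʳ-≤ 0≤c x≤y = ≤-respˡ-≈ (*-comm _ _) (≤-respʳ-≈ (*-comm _ _) (*-monoˡ-≤ 0≤c x≤y))

  *-inverse-pos : ∀ {x} → 0# < x → x * x ⁻¹ ≈ 1#
  *-inverse-pos (_ , 0≉x) = *-inverseʳ _ (λ x≈0 → 0≉x (sym x≈0))

  -- The inner product is `x ÷ c` unfolded, so the lemma clears the denominators in `Γ`, `Γ₂`,
  -- `av₁⁺` and `𝒦⁰∞` directly.
  *-cancel-⁻¹ : ∀ {c} → 0# < c → ∀ x → c * (x * c ⁻¹) ≈ x
  *-cancel-⁻¹ {c} 0<c x = begin
    c * (x * c ⁻¹)  ≈⟨ solve 3 (λ c x i → c :* (x :* i) := (c :* i) :* x) refl c x (c ⁻¹) ⟩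
    (c * c ⁻¹) * x  ≈⟨ *-congʳ (*-inverse-pos 0<c) ⟩
    1# * x          ≈⟨ *-identityˡ x ⟩
    x               ∎
    where open SetoidReasoning setoid

  -- If the inverse were at most `0#`, multiplying by `x` would give `1# ≤ 0#`.
  ⁻¹-pos : ∀ {x} → 0# < x → 0# < x ⁻¹
  ⁻¹-pos {x} 0<x with total 0# (x ⁻¹)
  ... | inj₁ 0≤x⁻¹ = 0≤x⁻¹ , λ 0≈x⁻¹ →
          0≉1 (trans (trans (sym (zeroʳ x)) (*-congˡ 0≈x⁻¹)) (*-inverse-pos 0<x))
  ... | inj₂ x⁻¹≤0 = contradiction (antisym (<⇒≤ 0<1) 1≤0) 0≉1
    where
    1≤0 : 1# ≤ 0#
    1≤0 = ≤-respˡ-≈ (*-inverse-pos 0<x) (≤-respʳ-≈ (zeroʳ x) (*-monoˡ-≤ (<⇒≤ 0<x) x⁻¹≤0))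

  *-cancelˡ-≤ : ∀ {c x y} → 0# < c → c * x ≤ c * y → x ≤ y
  *-cancelˡ-≤ {c} 0<c cx≤cy =
    ≤-respˡ-≈ (undo _) (≤-respʳ-≈ (undo _) (*-monoʳ-≤ (<⇒≤ (⁻¹-pos 0<c)) cx≤cy))
    where
    undo : ∀ x → (c * x) * c ⁻¹ ≈ x
    undo x = trans (*-assoc c x (c ⁻¹)) (*-cancel-⁻¹ 0<c x)

  *-pos : ∀ {x y} → 0# < x → 0# < y → 0# < x * y
  *-pos {x} {y} 0<x 0<y@(0≤y , 0≉y) = *-nonneg (<⇒≤ 0<x) 0≤y , λ 0≈xy →
    0≉y (antisym 0≤y (*-cancelˡ-≤ 0<x (≤-reflexive (trans (sym 0≈xy) (sym (zeroʳ x))))))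

  *-monoˡ-< : ∀ {c x y} → 0# < c → x < y → c * x < c * y
  *-monoˡ-< {c} {x} {y} 0<c x<y = <-excess (*-pos 0<c (x<y⇒0<y-x x<y))
    (solve 3 (λ c x y → c :* y := c :* x :+ c :* (y :- x)) refl c x y)

  neg-≤ : ∀ {x y} → x ≤ y → - y ≤ - x
  neg-≤ {x} {y} x≤y = ≤-excess (x≤y⇒0≤y-x x≤y)
    (solve 2 (λ x y → :- x := :- y :+ (y :- x)) refl x y)

  0≤∣x∣ : ∀ x → 0# ≤ ∣ x ∣
  0≤∣x∣ x with total 0# x
  ... | inj₁ 0≤x = 0≤x
  ... | inj₂ x≤0 = neg-nonneg x≤0

  x≤∣x∣ : ∀ x → x ≤ ∣ x ∣
  x≤∣x∣ x with total 0# x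
  ... | inj₁ 0≤x = ≤-refl
  ... | inj₂ x≤0 = ≤-trans x≤0 (neg-nonneg x≤0)

  -x≤∣x∣ : ∀ x → - x ≤ ∣ x ∣
  -x≤∣x∣ x with total 0# x
  ... | inj₁ 0≤x = ≤-excess (+-nonneg 0≤x 0≤x) (solve 1 (λ x → x := :- x :+ (x :+ x)) refl x)
  ... | inj₂ x≤0 = ≤-refl

  ∣x∣≤ : ∀ {x b} → x ≤ b → - x ≤ b → ∣ x ∣ ≤ b
  ∣x∣≤ {x} x≤b -x≤b with total 0# x
  ... | inj₁ _ = x≤b
  ... | inj₂ _ = -x≤b

  -- Monotonicity and convexity of the inverse on positive numbers.

  ⁻¹-difference : ∀ {x y} → 0# < x → 0# < y → x ⁻¹ ≈ y ⁻¹ + (y - x) * (x ⁻¹ * y ⁻¹)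
  ⁻¹-difference {x} {y} 0<x 0<y = begin
    x ⁻¹
      ≈⟨ *-cancel-⁻¹ 0<y (x ⁻¹) ⟨
    y * (x ⁻¹ * y ⁻¹)
      ≈⟨ solve 3 (λ x y w → y :* w := x :* w :+ (y :- x) :* w) refl x y (x ⁻¹ * y ⁻¹) ⟩
    x * (x ⁻¹ * y ⁻¹) + (y - x) * (x ⁻¹ * y ⁻¹)
      ≈⟨ +-congʳ (*-congˡ (*-comm _ _)) ⟩
    x * (y ⁻¹ * x ⁻¹) + (y - x) * (x ⁻¹ * y ⁻¹)
      ≈⟨ +-congʳ (*-cancel-⁻¹ 0<x (y ⁻¹)) ⟩
    y ⁻¹ + (y - x) * (x ⁻¹ * y ⁻¹)
      ∎
    where open SetoidReasoning setoid

  ⁻¹-antimono : ∀ {x y} → 0# < x → 0# < y → x ≤ y → y ⁻¹ ≤ x ⁻¹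
  ⁻¹-antimono 0<x 0<y x≤y = ≤-excess
    (*-nonneg (x≤y⇒0≤y-x x≤y) (*-nonneg (<⇒≤ (⁻¹-pos 0<x)) (<⇒≤ (⁻¹-pos 0<y))))
    (⁻¹-difference 0<x 0<y)

  -- Expand `a (1/a - n)² ≥ 0`. For positive `n` this says that the graph of the inverse lies above
  -- its tangent at `1/n`, which is `a ↦ 2n - a n²`.
  ⁻¹-≤-tangent : ∀ {a} → 0# < a → ∀ n → fromℕ 2 * n ≤ a ⁻¹ + a * (n * n)
  ⁻¹-≤-tangent {a} 0<a n = ≤-excess
    (*-nonneg (<⇒≤ 0<a) (0≤x*x (a ⁻¹ - n))) (begin
      a ⁻¹ + a * (n * n)
        ≈⟨ +-congʳ (*-cancel-⁻¹ 0<a (a ⁻¹)) ⟨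
      a * (a ⁻¹ * a ⁻¹) + a * (n * n)
        ≈⟨ solve 3 (λ a u n → a :* (u :* u) :+ a :* (n :* n)
             := :2 :* (a :* (n :* u)) :+ a :* ((u :- n) :* (u :- n)))
             refl a (a ⁻¹) n ⟩
      fromℕ 2 * (a * (n * a ⁻¹)) + a * ((a ⁻¹ - n) * (a ⁻¹ - n))
        ≈⟨ +-congʳ (*-congˡ (*-cancel-⁻¹ 0<a n)) ⟩
      fromℕ 2 * n + a * ((a ⁻¹ - n) * (a ⁻¹ - n))
        ∎)
    where open SetoidReasoning setoid

  module _ {α β : Carrier} (0≤α : 0# ≤ α) (0≤β : 0# ≤ β) (α+β≈1 : α + β ≈ 1#) where

    convex-constant : ∀ x → α * x + β * x ≈ x
    convex-constant x = trans (sym (distribʳ x α β)) (trans (*-congʳ α+β≈1) (*-identityˡ x))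

    convex-mono : ∀ {a b a′ b′} → a ≤ a′ → b ≤ b′ → α * a + β * b ≤ α * a′ + β * b′
    convex-mono a≤ b≤ = +-mono-≤ (*-monoˡ-≤ 0≤α a≤) (*-monoˡ-≤ 0≤β b≤)

    -- The smaller of `a` and `b` is a positive lower bound, which avoids asking which weight is
    -- nonzero.
    convex-pos : ∀ {a b} → 0# < a → 0# < b → 0# < α * a + β * b
    convex-pos {a} {b} 0<a 0<b with total a b
    ... | inj₁ a≤b = <-≤-trans 0<a (≤-respˡ-≈ (convex-constant a) (convex-mono ≤-refl a≤b))
    ... | inj₂ b≤a = <-≤-trans 0<b (≤-respˡ-≈ (convex-constant b) (convex-mono b≤a ≤-refl))

    -- Average the two tangent bounds, the tangent being taken at the convex combination itself.
    -- With `n` its inverse, the quadratic terms add up to a single `n`, which cancels against one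
    -- of the two on the left.
    ⁻¹-convex : ∀ {a b} → 0# < a → 0# < b →
                (α * a + β * b) ⁻¹ ≤ α * a ⁻¹ + β * b ⁻¹
    ⁻¹-convex {a} {b} 0<a 0<b = +-cancelʳ-≤ n (begin
      n + n
        ≈⟨ solve 1 (λ n → n :+ n := :2 :* n) refl n ⟩
      fromℕ 2 * n
        ≈⟨ convex-constant _ ⟨
      α * (fromℕ 2 * n) + β * (fromℕ 2 * n)
        ≤⟨ convex-mono (⁻¹-≤-tangent 0<a n) (⁻¹-≤-tangent 0<b n) ⟩
      α * (a ⁻¹ + a * (n * n)) + β * (b ⁻¹ + b * (n * n))
        ≈⟨ solve 7 (λ α β a b u v n →
             α :* (u :+ a :* (n :* n)) :+ β :* (v :+ b :* (n :* n))
             := (α :* u :+ β :* v) :+ (α :* a :+ β :* b) :* (n :* n))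
             refl α β a b (a ⁻¹) (b ⁻¹) n ⟩
      (α * a ⁻¹ + β * b ⁻¹) + (α * a + β * b) * (n * n)
        ≈⟨ +-congˡ (*-cancel-⁻¹ (convex-pos 0<a 0<b) n) ⟩
      (α * a ⁻¹ + β * b ⁻¹) + n
        ∎)
      where
      open ≤-Reasoning
      n = (α * a + β * b) ⁻¹

  -- Multiply by `b/a`. This turns a threshold `c/ε < N` into the estimate `c/N < ε` needed at
  -- infinity; the reversed version below serves the limit at zero.
  *⁻¹-<-swap : ∀ {a b c} → 0# < a → 0# < b → c * b ⁻¹ < a → c * a ⁻¹ < b
  *⁻¹-<-swap {a} {b} {c} 0<a 0<b c/b<a = begin-strict
    c * a ⁻¹                  ≈⟨ *-cancel-⁻¹ 0<b (c * a ⁻¹) ⟨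
    b * (c * a ⁻¹ * b ⁻¹)     ≈⟨ solve 4 (λ b c u v → b :* (c :* u :* v) := b :* u :* (c :* v))
                                   refl b c (a ⁻¹) (b ⁻¹) ⟩
    b * a ⁻¹ * (c * b ⁻¹)     <⟨ *-monoˡ-< (*-pos 0<b (⁻¹-pos 0<a)) c/b<a ⟩
    b * a ⁻¹ * a              ≈⟨ *-comm _ a ⟩
    a * (b * a ⁻¹)            ≈⟨ *-cancel-⁻¹ 0<a b ⟩
    b                         ∎
    where open ≤-Reasoning

  <-*⁻¹-swap : ∀ {a b c} → 0# < a → 0# < b → a < c * b ⁻¹ → b < c * a ⁻¹
  <-*⁻¹-swap {a} {b} {c} 0<a 0<b a<c/b = begin-strict
    b                         ≈⟨ *-cancel-⁻¹ 0<a b ⟨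
    a * (b * a ⁻¹)            ≈⟨ *-comm _ a ⟨
    b * a ⁻¹ * a              <⟨ *-monoˡ-< (*-pos 0<b (⁻¹-pos 0<a)) a<c/b ⟩
    b * a ⁻¹ * (c * b ⁻¹)     ≈⟨ solve 4 (λ b c u v → b :* (c :* u :* v) := b :* u :* (c :* v))
                                   refl b c (a ⁻¹) (b ⁻¹) ⟨
    b * (c * a ⁻¹ * b ⁻¹)     ≈⟨ *-cancel-⁻¹ 0<b (c * a ⁻¹) ⟩
    c * a ⁻¹                  ∎
    where open ≤-Reasoning

-- Finite sums, the Cauchy-Schwarz inequality and indicators.

module FiniteSums (ℝ : RealField) {A : Set} where
  open RealField ℝ
  open OrderedField ℝ

  ∑ : List A → (A → Carrier) → Carrier
  ∑ xs h = foldr _+_ 0# (map h xs)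

  ∑-cong : ∀ xs {g h : A → Carrier} → (∀ {y} → y ∈ xs → g y ≈ h y) → ∑ xs g ≈ ∑ xs h
  ∑-cong []       g≈h = refl
  ∑-cong (x ∷ xs) g≈h = +-cong (g≈h (here ≡.refl)) (∑-cong xs (λ y∈xs → g≈h (there y∈xs)))

  ∑-+ : ∀ xs (g h : A → Carrier) → ∑ xs (λ y → g y + h y) ≈ ∑ xs g + ∑ xs h
  ∑-+ []       g h = sym (+-identityˡ 0#)
  ∑-+ (x ∷ xs) g h = trans (+-congˡ (∑-+ xs g h))
    (solve 4 (λ a b s t → (a :+ b) :+ (s :+ t) := (a :+ s) :+ (b :+ t)) refl
      (g x) (h x) (∑ xs g) (∑ xs h))

  ∑-*ˡ : ∀ xs c (h : A → Carrier) → ∑ xs (λ y → c * h y) ≈ c * ∑ xs h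
  ∑-*ˡ []       c h = sym (zeroʳ c)
  ∑-*ˡ (x ∷ xs) c h = trans (+-congˡ (∑-*ˡ xs c h))
    (solve 3 (λ c a s → c :* a :+ c :* s := c :* (a :+ s)) refl c (h x) (∑ xs h))

  ∑-const : ∀ (xs : List A) c → ∑ xs (λ _ → c) ≈ fromℕ (length xs) * c
  ∑-const []       c = sym (zeroˡ c)
  ∑-const (x ∷ xs) c = trans (+-cong (sym (*-identityˡ c)) (∑-const xs c))
    (sym (distribʳ c 1# (fromℕ (length xs))))

  -- The usual way of splitting a sum below. The pointwise identity is asked for members of the list
  -- only, so that adjacency can be used when the list consists of neighbours.
  ∑-axpy : ∀ xs c {f g h : A → Carrier} → (∀ {y} → y ∈ xs → f y ≈ g y + c * h y) →
           ∑ xs f ≈ ∑ xs g + c * ∑ xs h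
  ∑-axpy xs c {g = g} {h} f≈ = trans (∑-cong xs f≈) (trans (∑-+ xs g _) (+-congˡ (∑-*ˡ xs c h)))

  ∑-mono-≤ : ∀ xs {g h : A → Carrier} → (∀ y → g y ≤ h y) → ∑ xs g ≤ ∑ xs h
  ∑-mono-≤ []       g≤h = ≤-refl
  ∑-mono-≤ (x ∷ xs) g≤h = +-mono-≤ (g≤h x) (∑-mono-≤ xs g≤h)

  ∑-nonneg : ∀ xs {h : A → Carrier} → (∀ y → 0# ≤ h y) → 0# ≤ ∑ xs h
  ∑-nonneg []       0≤h = ≤-refl
  ∑-nonneg (x ∷ xs) 0≤h = +-nonneg (0≤h x) (∑-nonneg xs 0≤h)

  -- The product of the sums contains all the diagonal products, and its mixed products are
  -- nonnegative.
  ∑-*-≤ : ∀ xs {g h : A → Carrier} → (∀ y → 0# ≤ g y) → (∀ y → 0# ≤ h y) →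
          ∑ xs (λ y → g y * h y) ≤ ∑ xs g * ∑ xs h
  ∑-*-≤ []       0≤g 0≤h = ≤-reflexive (sym (zeroˡ 0#))
  ∑-*-≤ (x ∷ xs) {g} {h} 0≤g 0≤h = ≤-trans (+-monoʳ-≤ _ (∑-*-≤ xs 0≤g 0≤h)) (≤-excess
    (+-nonneg (*-nonneg (0≤g x) (∑-nonneg xs 0≤h)) (*-nonneg (∑-nonneg xs 0≤g) (0≤h x)))
    (solve 4 (λ a b s t → (a :+ s) :* (b :+ t) := (a :* b :+ s :* t) :+ (a :* t :+ s :* b)) refl
      (g x) (h x) (∑ xs g) (∑ xs h)))

  -- Expand 0 ≤ ∑ (h y - b)².
  2b∑≤∑²+nb² : ∀ xs (h : A → Carrier) b →
    fromℕ 2 * (b * ∑ xs h) ≤ ∑ xs (λ y → h y * h y) + fromℕ (length xs) * (b * b)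
  2b∑≤∑²+nb² xs h b = ≤-excess (∑-nonneg xs (λ y → 0≤x*x (h y - b))) (sym (begin
    fromℕ 2 * (b * ∑ xs h) + ∑ xs (λ y → (h y - b) * (h y - b))
      ≈⟨ +-congˡ (∑-axpy xs (- (fromℕ 2 * b)) (λ {y} _ →
           solve 2 (λ y b → (y :- b) :* (y :- b) := (y :* y :+ b :* b) :+ (:- (:2 :* b)) :* y)
             refl (h y) b)) ⟩
    fromℕ 2 * (b * ∑ xs h) + (∑ xs (λ y → h y * h y + b * b) + - (fromℕ 2 * b) * ∑ xs h)
      ≈⟨ solve 3 (λ b s t → :2 :* (b :* s) :+ (t :+ (:- (:2 :* b)) :* s) := t) refl b _ _ ⟩
    ∑ xs (λ y → h y * h y + b * b)
      ≈⟨ ∑-+ xs _ _ ⟩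
    ∑ xs (λ y → h y * h y) + ∑ xs (λ _ → b * b)
      ≈⟨ +-congˡ (∑-const xs (b * b)) ⟩
    ∑ xs (λ y → h y * h y) + fromℕ (length xs) * (b * b)
      ∎))
    where open SetoidReasoning setoid

  -- Induction on the list: the cross term `2as` in `(a + s)²` is absorbed by `2b∑≤∑²+nb²` with
  -- `b = a`.
  cauchySchwarz : ∀ xs (h : A → Carrier) →
    ∑ xs h * ∑ xs h ≤ fromℕ (length xs) * ∑ xs (λ y → h y * h y)
  cauchySchwarz []       h = ≤-refl
  cauchySchwarz (x ∷ xs) h = begin
    (a + s) * (a + s)
      ≈⟨ solve 2 (λ a s → (a :+ s) :* (a :+ s) := (a :* a :+ :2 :* (a :* s)) :+ s :* s) refl a s ⟩
    (a * a + fromℕ 2 * (a * s)) + s * s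
      ≤⟨ +-mono-≤ (+-monoʳ-≤ (a * a) (2b∑≤∑²+nb² xs h a)) (cauchySchwarz xs h) ⟩
    (a * a + (q + n * (a * a))) + n * q
      ≈⟨ solve 3 (λ a q n → (a :* a :+ (q :+ n :* (a :* a))) :+ n :* q
           := (a :* a :+ q) :+ n :* (a :* a :+ q)) refl a q n ⟩
    (a * a + q) + n * (a * a + q)
      ≈⟨ +-congʳ (*-identityˡ _) ⟨
    1# * (a * a + q) + n * (a * a + q)
      ≈⟨ distribʳ _ 1# n ⟨
    (1# + n) * (a * a + q)
      ∎
    where
    open ≤-Reasoning
    a = h x
    s = ∑ xs h
    q = ∑ xs (λ y → h y * h y)
    n = fromℕ (length xs)

  𝟙 : {P : Set} → Dec P → Carrier
  𝟙 (yes _) = 1#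
  𝟙 (no _)  = 0#

  𝟙-true : {P : Set} → P → (P? : Dec P) → 𝟙 P? ≈ 1#
  𝟙-true p (yes _) = refl
  𝟙-true p (no ¬p) = contradiction p ¬p

  𝟙-false : {P : Set} → ¬ P → (P? : Dec P) → 𝟙 P? ≈ 0#
  𝟙-false ¬p (yes p) = contradiction p ¬p
  𝟙-false ¬p (no _)  = refl

  ∑-𝟙-filter : {P : A → Set} (P? : ∀ y → Dec (P y)) → ∀ xs →
               ∑ xs (λ y → 𝟙 (P? y)) ≈ fromℕ (length (filter P? xs))
  ∑-𝟙-filter P? []       = refl
  ∑-𝟙-filter P? (x ∷ xs) with P? x
  ... | yes _ = +-congˡ (∑-𝟙-filter P? xs)
  ... | no _  = trans (+-identityˡ _) (∑-𝟙-filter P? xs)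

  -- Since the list has no repetitions, exactly one summand is `1#`. For graphs: `x` is counted once
  -- among the neighbours of each of its neighbours.
  ∑-𝟙-≡ : ∀ {x} (≡x? : ∀ y → Dec (y ≡ x)) {xs} → Unique xs → x ∈ xs →
          ∑ xs (λ y → 𝟙 (≡x? y)) ≈ 1#
  ∑-𝟙-≡ {x} ≡x? {_ ∷ xs} (x∉xs ∷ _) (here ≡.refl) = begin
    𝟙 (≡x? x) + ∑ xs (λ y → 𝟙 (≡x? y))
      ≈⟨ +-cong (𝟙-true ≡.refl (≡x? x)) (∑-cong xs λ {y} y∈xs →
           𝟙-false (λ y≡x → All.lookup x∉xs y∈xs (≡.sym y≡x)) (≡x? y)) ⟩
    1# + ∑ xs (λ _ → 0#)
      ≈⟨ +-congˡ (trans (∑-const xs 0#) (zeroʳ _)) ⟩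
    1# + 0#
      ≈⟨ +-identityʳ 1# ⟩
    1#
      ∎
    where open SetoidReasoning setoid
  ∑-𝟙-≡ {x} ≡x? {z ∷ xs} (z∉xs ∷ unique) (there x∈xs) =
    trans (+-cong (𝟙-false (All.lookup z∉xs x∈xs) (≡x? z)) (∑-𝟙-≡ ≡x? unique x∈xs))
          (+-identityˡ 1#)

  𝟙-idem : {P : Set} (P? : Dec P) → 𝟙 P? * 𝟙 P? ≈ 𝟙 P?
  𝟙-idem (yes _) = *-identityˡ 1#
  𝟙-idem (no _)  = zeroˡ 0#

  𝟙-disjoint : {P Q : Set} → ¬ (P × Q) → (P? : Dec P) (Q? : Dec Q) → 𝟙 P? * 𝟙 Q? ≈ 0#
  𝟙-disjoint ¬pq (yes p) (yes q) = contradiction (p , q) ¬pq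
  𝟙-disjoint ¬pq (yes _) (no _)  = zeroʳ 1#
  𝟙-disjoint ¬pq (no _)  _       = zeroˡ _

-- `Γ` and `Γ₂` at a fixed vertex as sums over neighbours.

module CurvatureFunction
  (em : ExcludedMiddle 0ℓ) (ℝ : RealField) (G : Graph)
  (x : Graph.V G) (1≤degree : 1 ℕ.≤ Graph.degree G x)
  where
  open RealField ℝ
  open ExtendedDimension ℝ
  open Graph G
  open BakryÉmery em ℝ G
  open OrderedField ℝ
  open FiniteSums ℝ {V}

  d : Carrier
  d = fromℕ (degree x)

  0<d : 0# < d
  0<d = 0<fromℕ {degree x} 1≤degree

  0<2d : 0# < fromℕ 2 * d
  0<2d = *-pos 0<2 0<d

  energy : (V → Carrier) → V → Carrier
  energy f v = ∑∼ v (λ y → (f y - f v) * (f y - f v))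

  0≤energy : ∀ f v → 0# ≤ energy f v
  0≤energy f v = ∑-nonneg (neighbours v) (λ y → 0≤x*x (f y - f v))

  -- Split `a′b′ - ab` as `(a′ - a)(b′ - b) + a(b′ - b) + b(a′ - a)`. The sums of the last two terms
  -- are `f Δg` and `g Δf`, which the definition of `Γ` subtracts.
  2Γ≈ : ∀ f g v → fromℕ 2 * Γ f g v ≈ ∑∼ v (λ y → (f y - f v) * (g y - g v))
  2Γ≈ f g v = begin
    fromℕ 2 * Γ f g v
      ≈⟨ *-cancel-⁻¹ 0<2 _ ⟩
    Δ (f · g) v - f v * Δ g v - g v * Δ f v
      ≈⟨ +-congʳ (+-congʳ (∑-axpy ys (g v) (λ {y} _ →
           solve 4 (λ a b a′ b′ → a′ :* b′ :- a :* b
             := ((a′ :- a) :* (b′ :- b) :+ a :* (b′ :- b)) :+ b :* (a′ :- a))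
             refl (f v) (g v) (f y) (g y)))) ⟩
    (∑ ys (λ y → (f y - f v) * (g y - g v) + f v * (g y - g v)) + g v * Δ f v)
      - f v * Δ g v - g v * Δ f v
      ≈⟨ +-congʳ (+-congʳ (+-congʳ (∑-axpy ys (f v) (λ _ → refl)))) ⟩
    ((∑ ys (λ y → (f y - f v) * (g y - g v)) + f v * Δ g v) + g v * Δ f v)
      - f v * Δ g v - g v * Δ f v
      ≈⟨ solve 3 (λ s a b → ((s :+ a) :+ b) :- a :- b := s) refl _ (f v * Δ g v) (g v * Δ f v) ⟩
    ∑ ys (λ y → (f y - f v) * (g y - g v))
      ∎
    where
    open SetoidReasoning setoid
    ys = neighbours v

  0≤Γ : ∀ f v → 0# ≤ Γ f f v
  0≤Γ f v = *-cancelˡ-≤ 0<2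
    (≤-respˡ-≈ (sym (zeroʳ _)) (≤-respʳ-≈ (sym (2Γ≈ f f v)) (0≤energy f v)))

  Δ²≤2dΓ : ∀ f → Δ f x * Δ f x ≤ fromℕ 2 * d * Γ f f x
  Δ²≤2dΓ f = begin
    Δ f x * Δ f x           ≤⟨ cauchySchwarz (neighbours x) (λ y → f y - f x) ⟩
    d * energy f x          ≈⟨ *-congˡ (2Γ≈ f f x) ⟨
    d * (fromℕ 2 * Γ f f x) ≈⟨ solve 2 (λ d g → d :* (:2 :* g) := :2 :* d :* g) refl d (Γ f f x) ⟩
    fromℕ 2 * d * Γ f f x   ∎
    where open ≤-Reasoning

  -- The inner sum of `c² - 2bc` over the neighbours `z` of `y`, where `b = f y - f x` and
  -- `c = f z - f y`. It is the only part of `4Γ₂` that sees values of `f` at distance 2.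
  spread : (V → Carrier) → V → Carrier
  spread f y = energy f y - fromℕ 2 * ((f y - f x) * Δ f y)

  -- The term `2ΔΓ(f)` is the sum of the energies at the neighbours minus `d q`. Each mixed term
  -- `2Γ(f, Δf)` equals `m`, the sum of `b(y) (Δf(y) - Δf(x))`, so splitting off `Δf(x)` produces
  -- the square of `Δf(x)`.
  4Γ₂≈ : ∀ f → fromℕ 4 * Γ₂ f f x ≈
               ∑∼ x (spread f) - d * energy f x + fromℕ 2 * (Δ f x * Δ f x)
  4Γ₂≈ f = begin
    fromℕ 4 * Γ₂ f f x
      ≈⟨ solve 1 (λ g → :4 :* g := :2 :* (:2 :* g)) refl (Γ₂ f f x) ⟩
    fromℕ 2 * (fromℕ 2 * Γ₂ f f x)
      ≈⟨ *-congˡ (*-cancel-⁻¹ 0<2 _) ⟩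
    fromℕ 2 * (Δ (Γ f f) x - Γ f (Δ f) x - Γ (Δ f) f x)
      ≈⟨ solve 3 (λ a b c → :2 :* (a :- b :- c) := :2 :* a :- :2 :* b :- :2 :* c) refl _ _ _ ⟩
    fromℕ 2 * Δ (Γ f f) x - fromℕ 2 * Γ f (Δ f) x - fromℕ 2 * Γ (Δ f) f x
      ≈⟨ +-cong (+-congˡ (-‿cong (2Γ≈ f (Δ f) x))) (-‿cong (trans (2Γ≈ (Δ f) f x)
           (∑-cong ys (λ _ → *-comm _ _)))) ⟩
    fromℕ 2 * Δ (Γ f f) x - m - m
      -- Add and subtract `d q` and twice `(Δ f x)²`, to reach the right-hand sides of `∑energy≈`
      -- and `∑bΔ≈`.
      ≈⟨ solve 4 (λ a m q t → :2 :* a :- m :- m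
           := ((q :+ :2 :* a) :+ (:- :2) :* (m :+ t)) :- q :+ :2 :* t) refl
           (Δ (Γ f f) x) m (d * q) (Δ f x * Δ f x) ⟩
    ((d * q + fromℕ 2 * Δ (Γ f f) x) + - fromℕ 2 * (m + Δ f x * Δ f x))
      - d * q + fromℕ 2 * (Δ f x * Δ f x)
      ≈⟨ +-congʳ (+-congʳ (+-cong ∑energy≈ (*-congˡ ∑bΔ≈))) ⟨
    (∑ ys (energy f) + - fromℕ 2 * ∑ ys (λ y → (f y - f x) * Δ f y))
      - d * q + fromℕ 2 * (Δ f x * Δ f x)
      ≈⟨ +-congʳ (+-congʳ (∑-axpy ys (- fromℕ 2) (λ _ →
           solve 2 (λ e b → e :- :2 :* b := e :+ (:- :2) :* b) refl _ _))) ⟨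
    ∑ ys (spread f) - d * q + fromℕ 2 * (Δ f x * Δ f x)
      ∎
    where
    open SetoidReasoning setoid
    ys = neighbours x
    q = energy f x
    m = ∑ ys (λ y → (f y - f x) * (Δ f y - Δ f x))

    ∑energy≈ : ∑ ys (energy f) ≈ d * q + fromℕ 2 * Δ (Γ f f) x
    ∑energy≈ = trans
      (∑-axpy ys (fromℕ 2) {h = λ y → Γ f f y - Γ f f x} (λ {y} _ → begin
        energy f y
          ≈⟨ 2Γ≈ f f y ⟨
        fromℕ 2 * Γ f f y
          ≈⟨ solve 2 (λ a b → :2 :* a := :2 :* b :+ :2 :* (a :- b)) refl (Γ f f y) (Γ f f x) ⟩
        fromℕ 2 * Γ f f x + fromℕ 2 * (Γ f f y - Γ f f x)
          ≈⟨ +-congʳ (2Γ≈ f f x) ⟩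
        q + fromℕ 2 * (Γ f f y - Γ f f x)
          ∎))
      (+-congʳ (∑-const ys q))

    ∑bΔ≈ : ∑ ys (λ y → (f y - f x) * Δ f y) ≈ m + Δ f x * Δ f x
    ∑bΔ≈ = ∑-axpy ys (Δ f x) (λ {y} _ →
      solve 3 (λ b e c → b :* e := b :* (e :- c) :+ c :* b) refl (f y - f x) (Δ f y) (Δ f x))

  -- Admissible constants: a crude one, and the change of dimension.

  4*curvatureTerms : ∀ r s K f → fromℕ 4 * (r * s + K * Γ f f x) ≈
                     fromℕ 4 * (r * s) + fromℕ 2 * (K * energy f x)
  4*curvatureTerms r s K f = trans
    -- The factor 4 clears the halves in `Γ` and makes the inequality comparable with `4Γ₂≈`.
    (solve 3 (λ a K g → :4 :* (a :+ K :* g) := :4 :* a :+ :2 :* (K :* (:2 :* g))) refl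
      (r * s) K (Γ f f x))
    (+-congˡ (*-congˡ (*-congˡ (2Γ≈ f f x))))

  -- Completing the square in every summand of the sum over the neighbours z of y:
  -- c² - 2bc ≥ -b², where b = f y - f x and c = f z - f y.
  -energy≤∑spread : ∀ f →
    - (∑∼ x (λ y → fromℕ (degree y)) * energy f x) ≤ ∑∼ x (spread f)
  -energy≤∑spread f = ≤-trans
    -- Replacing the weighted sum of `d_y b(y)²` by the sum of all `d_y` times `q` is wasteful, but
    -- leaves a multiple of `q`.
    (neg-≤ (∑-*-≤ ys (λ y → 0≤fromℕ (degree y)) (λ y → 0≤x*x (b y))))
    (≤-excess (∑-nonneg ys 0≤spread+db²) (trans
      (solve 2 (λ s e → s := :- e :+ (s :+ e)) refl _ _)
      (+-congˡ (sym (∑-+ ys _ _)))))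
    where
    ys = neighbours x
    b : V → Carrier
    b y = f y - f x

    0≤spread+db² : ∀ y → 0# ≤ spread f y + fromℕ (degree y) * (b y * b y)
    0≤spread+db² y = ≤-respʳ-≈
      (solve 3 (λ e n c → (e :+ n) :- c := (e :- c) :+ n) refl _ _ _)
      (x≤y⇒0≤y-x (2b∑≤∑²+nb² (neighbours y) (λ z → f z - f y) (b y)))

  -- What remains of 4Γ₂ after dropping its term 2(Δ f x)² and bounding the spread below.
  crudeBound : Carrier
  crudeBound = - (∑∼ x (λ y → fromℕ (degree y)) + d) ÷ fromℕ 2

  -- Provides one admissible constant at infinity, where the coefficient of `(Δ f x)²` is `0#`.
  -- `CD-shift` carries it to every dimension, so each supremum is over a nonempty set.
  CD-crudeBound : CurvatureDimension x ⊤⁺ crudeBound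
  CD-crudeBound f = *-cancelˡ-≤ 0<4 (begin
    fromℕ 4 * (0# * S + crudeBound * Γ f f x)
      ≈⟨ 4*curvatureTerms 0# S crudeBound f ⟩
    fromℕ 4 * (0# * S) + fromℕ 2 * (crudeBound * q)
      ≈⟨ solve 3 (λ s k q → :4 :* (con (ℤ.+ 0) :* s) :+ :2 :* (k :* q) := (:2 :* k) :* q)
           refl S crudeBound q ⟩
    (fromℕ 2 * crudeBound) * q
      ≈⟨ *-congʳ (*-cancel-⁻¹ 0<2 _) ⟩
    - (D + d) * q
      ≈⟨ solve 3 (λ D d q → (:- (D :+ d)) :* q := :- (D :* q) :- d :* q) refl D d q ⟩
    - (D * q) - d * q
      ≤⟨ +-monoˡ-≤ (- (d * q)) (-energy≤∑spread f) ⟩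
    ∑∼ x (spread f) - d * q
      ≤⟨ ≤-excess (*-nonneg (<⇒≤ 0<2) (0≤x*x (Δ f x))) refl ⟩
    ∑∼ x (spread f) - d * q + fromℕ 2 * S
      ≈⟨ 4Γ₂≈ f ⟨
    fromℕ 4 * Γ₂ f f x
      ∎)
    where
    open ≤-Reasoning
    S = Δ f x * Δ f x
    q = energy f x
    D = ∑∼ x (λ y → fromℕ (degree y))

  -- The additional `t (Δf(x))²` is at most `2dt Γ(f)(x)`, which the lowered constant pays for.
  -- Existence, monotonicity, the lower bound and continuity are all instances.
  CD-shift : ∀ N M {K t} → 0# ≤ t → recip M ≤ recip N + t →
             CurvatureDimension x N K → CurvatureDimension x M (K - fromℕ 2 * d * t)
  CD-shift N M {K} {t} 0≤t r≤ cd f = begin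
    recip M * S + (K - fromℕ 2 * d * t) * g
      ≤⟨ +-monoˡ-≤ _ (*-monoʳ-≤ (0≤x*x (Δ f x)) r≤) ⟩
    (recip N + t) * S + (K - fromℕ 2 * d * t) * g
      ≈⟨ solve 6 (λ r t S K d g → (r :+ t) :* S :+ (K :- :2 :* d :* t) :* g
           := (r :* S :+ K :* g) :+ (t :* S :- t :* (:2 :* d :* g))) refl (recip N) t S K d g ⟩
    (recip N * S + K * g) + (t * S - t * (fromℕ 2 * d * g))
      ≤⟨ +-mono-≤ (cd f) (+-monoˡ-≤ _ (*-monoˡ-≤ 0≤t (Δ²≤2dΓ f))) ⟩
    Γ₂ f f x + (t * (fromℕ 2 * d * g) - t * (fromℕ 2 * d * g))
      ≈⟨ +-congˡ (-‿inverseʳ _) ⟩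
    Γ₂ f f x + 0#
      ≈⟨ +-identityʳ _ ⟩
    Γ₂ f f x
      ∎
    where
    open ≤-Reasoning
    S = Δ f x * Δ f x
    g = Γ f f x

  -- The radial test function and the upper bound.

  at2? : ∀ z → Dec (AtDistance x z 2)
  at2? z = em

  ≡x? : ∀ z → Dec (z ≡ x)
  ≡x? z = em

  -- Up to a constant, the distance from x near x: it is -1 at x, 0 on the sphere of
  -- radius 1 and 1 on the sphere of radius 2.
  radial : V → Carrier
  radial z = 𝟙 (at2? z) - 𝟙 (≡x? z)

  radial-square : ∀ z → radial z * radial z ≈ 𝟙 (at2? z) + 𝟙 (≡x? z)
  radial-square z = begin
    (a - b) * (a - b)
      ≈⟨ solve 2 (λ a b → (a :- b) :* (a :- b) := (a :* a :+ b :* b) :- :2 :* (a :* b)) refl a b ⟩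
    (a * a + b * b) - fromℕ 2 * (a * b)
      ≈⟨ +-cong (+-cong (𝟙-idem (at2? z)) (𝟙-idem (≡x? z)))
           (-‿cong (*-congˡ (𝟙-disjoint ¬at2×≡x (at2? z) (≡x? z)))) ⟩
    (a + b) - fromℕ 2 * 0#
      ≈⟨ solve 1 (λ c → c :- :2 :* con (ℤ.+ 0) := c) refl (a + b) ⟩
    a + b
      ∎
    where
    open SetoidReasoning setoid
    a = 𝟙 (at2? z)
    b = 𝟙 (≡x? z)
    ¬at2×≡x : ¬ (AtDistance x z 2 × z ≡ x)
    ¬at2×≡x ((_ , shorter) , ≡.refl) = shorter 0 (ℕ.s≤s ℕ.z≤n) Walk.here

  radial-x : radial x ≈ - 1#
  radial-x = trans
    (+-cong (𝟙-false (λ (_ , shorter) → shorter 0 (ℕ.s≤s ℕ.z≤n) Walk.here) (at2? x))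
            (-‿cong (𝟙-true ≡.refl (≡x? x))))
    (+-identityˡ _)

  radial-∼x : ∀ {y} → x ∼ y → radial y ≈ 0#
  radial-∼x {y} x∼y = trans
    (+-cong (𝟙-false (λ (_ , shorter) →
              shorter 1 (ℕ.s≤s (ℕ.s≤s ℕ.z≤n)) (Walk.step x∼y Walk.here)) (at2? y))
            (-‿cong (𝟙-false (λ y≡x → ∼-irrefl (≡.sym y≡x) x∼y) (≡x? y))))
    (-‿inverseʳ 0#)

  ∼⇒∈ : ∀ {u v} → u ∼ v → v ∈ neighbours u
  ∼⇒∈ {u} {v} = Equivalence.from (∈-neighbours u v)

  ∈⇒∼ : ∀ {u v} → v ∈ neighbours u → u ∼ v
  ∈⇒∼ {u} {v} = Equivalence.to (∈-neighbours u v)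

  radial-step : ∀ {y} → x ∼ y → radial y - radial x ≈ 1#
  radial-step x∼y = trans (+-cong (radial-∼x x∼y) (-‿cong radial-x))
    (solve 1 (λ e → con (ℤ.+ 0) :- :- e := e) refl 1#)

  module _ {y} (x∼y : x ∼ y) where
    private
      d⁺ = fromℕ (outDegree x y)
      zs = neighbours y

      radial-step′ : ∀ z → radial z - radial y ≈ radial z
      radial-step′ z = trans (+-congˡ (-‿cong (radial-∼x x∼y)))
        (solve 1 (λ a → a :- con (ℤ.+ 0) := a) refl (radial z))

      ∑at2 : ∑ zs (λ z → 𝟙 (at2? z)) ≈ d⁺
      -- `at2?` is the very decision used in `outDegree`, so the filtered lists agree by definition.
      ∑at2 = ∑-𝟙-filter at2? zs

      ∑≡x : ∑ zs (λ z → 𝟙 (≡x? z)) ≈ 1#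
      ∑≡x = ∑-𝟙-≡ ≡x? (neighbours-unique y) (∼⇒∈ (∼-sym x∼y))

    -- From `y`, each neighbour at distance 2 contributes `1#`, the vertex `x` contributes `- 1#`,
    -- and the neighbours shared with `x` contribute nothing.
    Δ-radial-∼x : Δ radial y ≈ d⁺ - 1#
    Δ-radial-∼x = trans
      (∑-axpy zs (- 1#) (λ {z} _ → trans (radial-step′ z)
        (+-congˡ (trans (-‿cong (sym (*-identityˡ _)))
          (solve 2 (λ e a → :- (e :* a) := (:- e) :* a) refl 1# (𝟙 (≡x? z)))))))
      (+-cong ∑at2 (trans (*-congˡ ∑≡x) (*-identityʳ _)))

    energy-radial-∼x : energy radial y ≈ d⁺ + 1#
    energy-radial-∼x = trans
      (∑-cong zs (λ {z} _ → trans (*-cong (radial-step′ z) (radial-step′ z)) (radial-square z)))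
      (trans (∑-+ zs _ _) (+-cong ∑at2 ∑≡x))

    spread-radial : spread radial y ≈ fromℕ 3 + - 1# * d⁺
    spread-radial = begin
      energy radial y - fromℕ 2 * ((radial y - radial x) * Δ radial y)
        ≈⟨ +-cong energy-radial-∼x (-‿cong (*-congˡ
             (trans (*-cong (radial-step x∼y) Δ-radial-∼x) (*-identityˡ _)))) ⟩
      (d⁺ + 1#) - fromℕ 2 * (d⁺ - 1#)
        -- The variable `e` stands for `1#`, and the nested sum is `fromℕ 3` unfolded.
        ≈⟨ solve 2 (λ d e → (d :+ e) :- :2 :* (d :- e)
             := (e :+ (e :+ (e :+ con (ℤ.+ 0)))) :- d) refl d⁺ 1# ⟩
      fromℕ 3 - d⁺
        ≈⟨ +-congˡ (-‿cong (*-identityˡ d⁺)) ⟨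
      fromℕ 3 - 1# * d⁺
        ≈⟨ +-congˡ (solve 2 (λ e d → :- (e :* d) := (:- e) :* d) refl 1# d⁺) ⟩
      fromℕ 3 + - 1# * d⁺
        ∎
      where open SetoidReasoning setoid

  Δ-radial-x : Δ radial x ≈ d
  Δ-radial-x = trans (∑-cong (neighbours x) (λ y∈ → radial-step (∈⇒∼ y∈)))
    (trans (∑-const (neighbours x) 1#) (*-identityʳ d))

  energy-radial-x : energy radial x ≈ d
  energy-radial-x = trans
    (∑-cong (neighbours x) (λ y∈ →
      trans (*-cong (radial-step (∈⇒∼ y∈)) (radial-step (∈⇒∼ y∈))) (*-identityˡ 1#)))
    (trans (∑-const (neighbours x) 1#) (*-identityʳ d))

  -- Both `Δ` and the energy of `radial` at `x` are `d`, so `4Γ₂≈` gives `(3d - d av) - d² + 2d²`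
  -- with `av = av₁⁺ x`. Hence `𝒦⁰∞ x` is the quotient of `Γ₂` by `Γ` for this function.
  4Γ₂-radial : fromℕ 4 * Γ₂ radial radial x ≈ fromℕ 2 * d * 𝒦⁰∞ x
  4Γ₂-radial = begin
    fromℕ 4 * Γ₂ radial radial x
      ≈⟨ 4Γ₂≈ radial ⟩
    ∑∼ x (spread radial) - d * energy radial x + fromℕ 2 * (Δ radial x * Δ radial x)
      ≈⟨ +-cong (+-cong ∑spread≈ (-‿cong (*-congˡ energy-radial-x)))
           (*-congˡ (*-cong Δ-radial-x Δ-radial-x)) ⟩
    (d * fromℕ 3 - d * av₁⁺ x) - d * d + fromℕ 2 * (d * d)
      ≈⟨ solve 3 (λ d c a → (d :* c :- d :* a) :- d :* d :+ :2 :* (d :* d)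
           := d :* (c :+ d :- a)) refl d (fromℕ 3) (av₁⁺ x) ⟩
    d * (fromℕ 3 + d - av₁⁺ x)
      ≈⟨ *-congˡ (*-cancel-⁻¹ 0<2 _) ⟨
    d * (fromℕ 2 * 𝒦⁰∞ x)
      ≈⟨ solve 2 (λ d k → d :* (:2 :* k) := :2 :* d :* k) refl d (𝒦⁰∞ x) ⟩
    fromℕ 2 * d * 𝒦⁰∞ x
      ∎
    where
    open SetoidReasoning setoid
    ys = neighbours x
    ∑d⁺ = ∑ ys (λ y → fromℕ (outDegree x y))

    ∑spread≈ : ∑ ys (spread radial) ≈ d * fromℕ 3 - d * av₁⁺ x
    ∑spread≈ = begin
      ∑ ys (spread radial)
        ≈⟨ ∑-axpy ys (- 1#) (λ y∈ → spread-radial (∈⇒∼ y∈)) ⟩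
      ∑ ys (λ _ → fromℕ 3) + - 1# * ∑d⁺
        ≈⟨ +-cong (∑-const ys (fromℕ 3))
             (solve 2 (λ e s → (:- e) :* s := :- (e :* s)) refl 1# ∑d⁺) ⟩
      d * fromℕ 3 - 1# * ∑d⁺
        ≈⟨ +-congˡ (-‿cong (trans (*-identityˡ ∑d⁺) (sym (*-cancel-⁻¹ 0<d ∑d⁺)))) ⟩
      d * fromℕ 3 - d * av₁⁺ x
        ∎

  -- Testing with `radial` turns four times the inequality into `4d²/N + 2dK ≤ 2d 𝒦⁰∞`; divide by
  -- `2d`.
  CD⇒K≤ : ∀ N {K} → CurvatureDimension x N K → K ≤ 𝒦⁰∞ x - fromℕ 2 * d * recip N
  CD⇒K≤ N {K} cd = *-cancelˡ-≤ 0<2d (begin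
    fromℕ 2 * d * K
      ≈⟨ solve 3 (λ d k r → :2 :* d :* k
           := (:4 :* (r :* (d :* d)) :+ :2 :* (k :* d)) :- :4 :* (r :* (d :* d))) refl d K r ⟩
    (fromℕ 4 * (r * (d * d)) + fromℕ 2 * (K * d)) - fromℕ 4 * (r * (d * d))
      ≈⟨ +-congʳ (+-cong (*-congˡ (*-congˡ (*-cong Δ-radial-x Δ-radial-x)))
           (*-congˡ (*-congˡ energy-radial-x))) ⟨
    (fromℕ 4 * (r * S) + fromℕ 2 * (K * energy radial x)) - fromℕ 4 * (r * (d * d))
      ≈⟨ +-congʳ (4*curvatureTerms r S K radial) ⟨
    fromℕ 4 * (r * S + K * Γ radial radial x) - fromℕ 4 * (r * (d * d))
      ≤⟨ +-monoˡ-≤ _ (*-monoˡ-≤ (<⇒≤ 0<4) (cd radial)) ⟩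
    fromℕ 4 * Γ₂ radial radial x - fromℕ 4 * (r * (d * d))
      ≈⟨ +-congʳ 4Γ₂-radial ⟩
    fromℕ 2 * d * 𝒦⁰∞ x - fromℕ 4 * (r * (d * d))
      ≈⟨ solve 3 (λ d k r → :2 :* d :* k :- :4 :* (r :* (d :* d))
           := :2 :* d :* (k :- :2 :* d :* r)) refl d (𝒦⁰∞ x) r ⟩
    fromℕ 2 * d * (𝒦⁰∞ x - fromℕ 2 * d * r)
      ∎)
    where
    open ≤-Reasoning
    r = recip N
    S = Δ radial x * Δ radial x

  -- Existence of the greatest admissible constant.

  0≤recip : ∀ N → 0# ≤ recip N
  0≤recip [ N , 0<N ] = <⇒≤ (⁻¹-pos 0<N)
  0≤recip ⊤⁺          = ≤-refl

  recip-antimono : ∀ {N M} → N ≤ᴰ M → recip M ≤ recip N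
  recip-antimono {[ _ , 0<N ]} {[ _ , 0<M ]} AddSupremum.[ N≤M ] = ⁻¹-antimono 0<N 0<M N≤M
  recip-antimono (N AddSupremum.≤⊤⁺) = 0≤recip N

  -- For a fixed `f` the condition is affine in `K`. If `Γ(f)(x)` vanishes it does not involve `K`,
  -- and any admissible `K₀` proves it. Otherwise it reads `K ≤ b` for a quotient `b`, which
  -- therefore bounds all admissible constants and hence `s`.
  sup-CD : ∀ N {s} → ∃[ K ] CurvatureDimension x N K →
           (∀ b → IsUpperBound b (CurvatureDimension x N) → s ≤ b) →
           CurvatureDimension x N s
  sup-CD N {s} (K₀ , cd₀) least f with em {0# ≈ Γ f f x}
  ... | yes 0≈g = begin
    recip N * S + s * g    ≈⟨ +-congˡ (*-congˡ 0≈g) ⟨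
    recip N * S + s * 0#   ≈⟨ +-congˡ (trans (zeroʳ s) (sym (zeroʳ K₀))) ⟩
    recip N * S + K₀ * 0#  ≈⟨ +-congˡ (*-congˡ 0≈g) ⟩
    recip N * S + K₀ * g   ≤⟨ cd₀ f ⟩
    Γ₂ f f x               ∎
    where
    open ≤-Reasoning
    S = Δ f x * Δ f x
    g = Γ f f x
  ... | no 0≉g = begin
    recip N * S + s * g           ≤⟨ +-monoʳ-≤ _ (*-monoʳ-≤ (0≤Γ f x) (least b isUpperBound)) ⟩
    recip N * S + b * g           ≈⟨ +-congˡ (trans (*-comm b g) (*-cancel-⁻¹ 0<g _)) ⟩
    recip N * S + (Γ₂ f f x - recip N * S) ≈⟨ x+[y-x]≈y _ _ ⟩
    Γ₂ f f x                      ∎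
    where
    open ≤-Reasoning
    S = Δ f x * Δ f x
    g = Γ f f x
    0<g : 0# < g
    0<g = 0≤Γ f x , 0≉g
    b = (Γ₂ f f x - recip N * S) ÷ g

    isUpperBound : IsUpperBound b (CurvatureDimension x N)
    isUpperBound {K} cd = *-cancelˡ-≤ 0<g (begin
      g * K
        ≈⟨ solve 3 (λ g K a → g :* K := (a :+ K :* g) :- a) refl g K (recip N * S) ⟩
      (recip N * S + K * g) - recip N * S
        ≤⟨ +-monoˡ-≤ _ (cd f) ⟩
      Γ₂ f f x - recip N * S
        ≈⟨ *-cancel-⁻¹ 0<g _ ⟨
      g * b
        ∎)

  curvatureFunction : ∃[ 𝒦 ] IsCurvatureFunction x 𝒦
  curvatureFunction = (λ N → proj₁ (greatest N)) , (λ N → proj₂ (greatest N))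
    where
    greatest : ∀ N → ∃[ K ] IsGreatest K (CurvatureDimension x N)
    greatest N =
      -- Shift from infinity with `t = recip N`.
      let nonempty = _ , CD-shift ⊤⁺ N (0≤recip N) (≤-reflexive (sym (+-identityˡ _))) CD-crudeBound
          s , isUpperBound , least = complete (CurvatureDimension x N) nonempty (_ , CD⇒K≤ N)
      in s , sup-CD N nonempty least , isUpperBound

  -- The properties claimed for the curvature function.

  module Properties {𝒦 : Dim → Carrier} (isCurvatureFunction : IsCurvatureFunction x 𝒦) where

    CD-𝒦 : ∀ N → CurvatureDimension x N (𝒦 N)
    CD-𝒦 N = proj₁ (isCurvatureFunction N)

    𝒦-maximal : ∀ N → IsUpperBound (𝒦 N) (CurvatureDimension x N)
    𝒦-maximal N = proj₂ (isCurvatureFunction N)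

    𝒦-shift : ∀ N M {t} → 0# ≤ t → recip M ≤ recip N + t → 𝒦 N - fromℕ 2 * d * t ≤ 𝒦 M
    𝒦-shift N M 0≤t r≤ = 𝒦-maximal M (CD-shift N M 0≤t r≤ (CD-𝒦 N))

    nonDecreasing : NonDecreasing 𝒦
    nonDecreasing {N} {M} N≤M = ≤-respˡ-≈
      (solve 2 (λ K d → K :- :2 :* d :* con (ℤ.+ 0) := K) refl (𝒦 N) d)
      -- The shift with `t = 0#` costs nothing.
      (𝒦-shift N M ≤-refl (≤-respʳ-≈ (sym (+-identityʳ _)) (recip-antimono N≤M)))

    lowerBound : ∀ N → 𝒦 ⊤⁺ - fromℕ 2 * d * recip N ≤ 𝒦 N
    lowerBound N = 𝒦-shift ⊤⁺ N (0≤recip N) (≤-reflexive (sym (+-identityˡ _)))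

    upperBound : ∀ N → 𝒦 N ≤ 𝒦⁰∞ x - fromℕ 2 * d * recip N
    upperBound N = CD⇒K≤ N (CD-𝒦 N)

    -- The last two hypotheses say that the reciprocals differ by at most `t`; each gives one
    -- direction through `𝒦-shift`.
    lipschitz : ∀ N M {t} → 0# ≤ t → recip M ≤ recip N + t → recip N ≤ recip M + t →
                ∣ 𝒦 N - 𝒦 M ∣ ≤ fromℕ 2 * d * t
    lipschitz N M {t} 0≤t rM≤ rN≤ = ∣x∣≤
      (≤-respʳ-≈ (solve 2 (λ a c → a :+ (c :- a) := c) refl _ _)
        (≤-respˡ-≈ (solve 3 (λ a b c → (a :- c) :+ (c :- b) := a :- b) refl _ _ _)
          (+-monoˡ-≤ (c - 𝒦 M) (𝒦-shift N M 0≤t rM≤))))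
      (≤-respʳ-≈ (solve 2 (λ a c → a :+ (c :- a) := c) refl _ _)
        (≤-respˡ-≈ (solve 3 (λ a b c → (b :- c) :+ (c :- a) := :- (a :- b)) refl _ _ _)
          (+-monoˡ-≤ (c - 𝒦 N) (𝒦-shift M N 0≤t rN≤))))
      where c = fromℕ 2 * d * t

    continuous : Continuous 𝒦
    -- Here `t = 1/N`, and `N` beyond `2d/ε` gives `2d/N < ε`.
    continuous ⊤⁺ ε 0<ε = fromℕ 2 * d * ε ⁻¹ , *-pos 0<2d (⁻¹-pos 0<ε) , λ N 0<N M<N →
      ≤-<-trans
        (lipschitz [ N , 0<N ] ⊤⁺ (0≤recip [ N , 0<N ])
          (+-nonneg (0≤recip [ N , 0<N ]) (0≤recip [ N , 0<N ]))
          (≤-reflexive (sym (+-identityˡ _))))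
        (*⁻¹-<-swap 0<N 0<ε M<N)
    continuous [ N₀ , 0<N₀ ] ε 0<ε = δ , 0<δ , close
      where
      -- δ solves 2dδ = ε N₀ (N₀ - δ), so that |N - N₀| < δ gives 2d|N - N₀| < ε N₀ N.
      e = fromℕ 2 * d + ε * N₀
      0<e : 0# < e
      0<e = +-pos-nonneg 0<2d (<⇒≤ (*-pos 0<ε 0<N₀))
      δ = ε * N₀ * N₀ * e ⁻¹
      0<δ : 0# < δ
      0<δ = *-pos (*-pos (*-pos 0<ε 0<N₀) 0<N₀) (⁻¹-pos 0<e)

      close : ∀ N (0<N : 0# < N) → ∣ N - N₀ ∣ < δ → ∣ 𝒦 [ N , 0<N ] - 𝒦 [ N₀ , 0<N₀ ] ∣ < ε
      close N 0<N w<δ = ≤-<-trans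
        -- By `⁻¹-difference`, the reciprocals differ by exactly `t = w u v`, that is, the distance
        -- from `N` to `N₀` divided by `N N₀`.
        (lipschitz [ N , 0<N ] [ N₀ , 0<N₀ ] (*-nonneg (0≤∣x∣ _) (<⇒≤ 0<uv))
          (≤-respˡ-≈ (sym (⁻¹-difference 0<N₀ 0<N))
            (+-monoʳ-≤ u (≤-respˡ-≈ (*-congˡ (*-comm u v))
              (*-monoʳ-≤ (<⇒≤ 0<uv) (x≤∣x∣ (N - N₀))))))
          (≤-respˡ-≈ (sym (⁻¹-difference 0<N 0<N₀))
            (+-monoʳ-≤ v (*-monoʳ-≤ (<⇒≤ 0<uv) N₀-N≤w))))
        2dt<ε
        where
        open ≤-Reasoning
        w = ∣ N - N₀ ∣
        u = N ⁻¹
        v = N₀ ⁻¹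
        0<uv : 0# < u * v
        0<uv = *-pos (⁻¹-pos 0<N) (⁻¹-pos 0<N₀)

        N₀-N≤w : N₀ - N ≤ w
        N₀-N≤w = ≤-respˡ-≈ (solve 2 (λ a b → :- (a :- b) := b :- a) refl N N₀) (-x≤∣x∣ (N - N₀))

        N₀-δ≤N : N₀ - δ ≤ N
        N₀-δ≤N = ≤-excess (x≤y⇒0≤y-x (≤-trans N₀-N≤w (<⇒≤ w<δ)))
          (solve 3 (λ a b δ → a := (b :- δ) :+ (δ :- (b :- a))) refl N N₀ δ)

        2dw<εN₀N : fromℕ 2 * d * w < ε * N₀ * N
        2dw<εN₀N = begin-strict
          fromℕ 2 * d * w
            <⟨ *-monoˡ-< 0<2d w<δ ⟩
          fromℕ 2 * d * δ
            ≈⟨ solve 3 (λ c a δ → c :* δ := (c :+ a) :* δ :- a :* δ) refl (fromℕ 2 * d) (ε * N₀) δ ⟩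
          e * δ - ε * N₀ * δ
            ≈⟨ +-congʳ (*-cancel-⁻¹ 0<e _) ⟩
          ε * N₀ * N₀ - ε * N₀ * δ
            ≈⟨ solve 3 (λ a b δ → a :* b :- a :* δ := a :* (b :- δ)) refl (ε * N₀) N₀ δ ⟩
          ε * N₀ * (N₀ - δ)
            ≤⟨ *-monoˡ-≤ (<⇒≤ (*-pos 0<ε 0<N₀)) N₀-δ≤N ⟩
          ε * N₀ * N
            ∎

        2dt<ε : fromℕ 2 * d * (w * (u * v)) < ε
        2dt<ε = begin-strict
          fromℕ 2 * d * (w * (u * v))
            ≈⟨ solve 3 (λ c w p → c :* (w :* p) := p :* (c :* w)) refl (fromℕ 2 * d) w (u * v) ⟩
          u * v * (fromℕ 2 * d * w)
            <⟨ *-monoˡ-< 0<uv 2dw<εN₀N ⟩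
          u * v * (ε * N₀ * N)
            ≈⟨ solve 5 (λ u v ε b a → u :* v :* (ε :* b :* a) := a :* (b :* (ε :* v) :* u))
                 refl u v ε N₀ N ⟩
          N * (N₀ * (ε * v) * u)
            ≈⟨ *-cancel-⁻¹ 0<N _ ⟩
          N₀ * (ε * v)
            ≈⟨ *-cancel-⁻¹ 0<N₀ ε ⟩
          ε
            ∎

    tendsTo-∞At0 : TendsTo-∞At0 𝒦
    -- Below `2d/E` the term `2d/N` exceeds `E`, which pushes the upper bound below `B`.
    tendsTo-∞At0 B = fromℕ 2 * d * E ⁻¹ , *-pos 0<2d (⁻¹-pos 0<E) , λ N 0<N N<δ → begin-strict
      𝒦 [ N , 0<N ]
        ≤⟨ upperBound [ N , 0<N ] ⟩
      𝒦⁰∞ x - fromℕ 2 * d * N ⁻¹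
        <⟨ <-excess (x<y⇒0<y-x (<-*⁻¹-swap 0<N 0<E N<δ))
             (solve 3 (λ k c e → k :- e := (k :- c) :+ (c :- e)) refl _ _ E) ⟩
      𝒦⁰∞ x - E
        ≤⟨ ≤-excess (≤-trans (<⇒≤ 0<1) 1≤E-C)
             (solve 3 (λ k b e → b := (k :- e) :+ (e :- (k :- b))) refl _ _ E) ⟩
      B
        ∎
      where
      open ≤-Reasoning
      C = 𝒦⁰∞ x - B
      -- Chosen positive whatever the sign of `C`, and larger than `C`.
      E = ∣ C ∣ + 1#
      0<E : 0# < E
      0<E = +-nonneg-pos (0≤∣x∣ C) 0<1
      1≤E-C : 1# ≤ E - C
      1≤E-C = ≤-excess (x≤y⇒0≤y-x (x≤∣x∣ C))
        (solve 3 (λ a e c → (a :+ e) :- c := e :+ (a :- c)) refl ∣ C ∣ 1# C)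

    -- For each `f`, average the curvature inequalities at `N₁` and `N₂`. By convexity the averaged
    -- reciprocal is at least the reciprocal of the averaged dimension, so the averaged constant is
    -- admissible there, and maximality concludes.
    concave : Concave 𝒦
    concave N₁ N₂ 0<N₁ 0<N₂ α 0≤α α≤1 = 0<N , 𝒦-maximal [ N , 0<N ] λ f →
      let S = Δ f x * Δ f x
          g = Γ f f x
      in begin
      N ⁻¹ * S + (α * K₁ + β * K₂) * g
        ≤⟨ +-monoˡ-≤ _ (*-monoʳ-≤ (0≤x*x (Δ f x)) (⁻¹-convex 0≤α 0≤β α+β≈1 0<N₁ 0<N₂)) ⟩
      (α * N₁ ⁻¹ + β * N₂ ⁻¹) * S + (α * K₁ + β * K₂) * g
        ≈⟨ solve 8 (λ α β u v k l S g → (α :* u :+ β :* v) :* S :+ (α :* k :+ β :* l) :* g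
             := α :* (u :* S :+ k :* g) :+ β :* (v :* S :+ l :* g))
             refl α β (N₁ ⁻¹) (N₂ ⁻¹) K₁ K₂ S g ⟩
      α * (N₁ ⁻¹ * S + K₁ * g) + β * (N₂ ⁻¹ * S + K₂ * g)
        ≤⟨ convex-mono 0≤α 0≤β α+β≈1 (CD-𝒦 [ N₁ , 0<N₁ ] f) (CD-𝒦 [ N₂ , 0<N₂ ] f) ⟩
      α * Γ₂ f f x + β * Γ₂ f f x
        ≈⟨ convex-constant 0≤α 0≤β α+β≈1 (Γ₂ f f x) ⟩
      Γ₂ f f x
        ∎
      where
      open ≤-Reasoning
      β = 1# - α
      N = α * N₁ + β * N₂
      K₁ = 𝒦 [ N₁ , 0<N₁ ]
      K₂ = 𝒦 [ N₂ , 0<N₂ ]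
      0≤β : 0# ≤ β
      0≤β = x≤y⇒0≤y-x α≤1
      α+β≈1 : α + β ≈ 1#
      α+β≈1 = x+[y-x]≈y α 1#
      0<N : 0# < N
      0<N = convex-pos 0≤α 0≤β α+β≈1 0<N₁ 0<N₂

proposition4p1 :
  ∀ (em : ExcludedMiddle 0ℓ) (ℝ : RealField) (G : Graph) →
  let open RealField ℝ
      open ExtendedDimension ℝ
      open Graph G
      open BakryÉmery em ℝ G
  in
  ∀ (x : V) → 1 ℕ.≤ degree x →
  (∃[ 𝒦 ] IsCurvatureFunction x 𝒦) ×
  (∀ (𝒦 : Dim → Carrier) → IsCurvatureFunction x 𝒦 →
    NonDecreasing 𝒦 ×
    Continuous 𝒦 ×
    (∀ (N : Dim) →
      (𝒦 ⊤⁺ - fromℕ 2 * fromℕ (degree x) * recip N ≤ 𝒦 N) ×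
      (𝒦 N ≤ 𝒦⁰∞ x - fromℕ 2 * fromℕ (degree x) * recip N)) ×
    TendsTo-∞At0 𝒦 ×
    Concave 𝒦)
proposition4p1 em ℝ G x 1≤degree = curvatureFunction , λ 𝒦 isCurvatureFunction →
  let open Properties isCurvatureFunction in
  nonDecreasing , continuous , (λ N → lowerBound N , upperBound N) , tendsTo-∞At0 , concave
  where open CurvatureFunction em ℝ G x 1≤degree
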